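{- Let $R$ be a finite commutative ring, let $D=\{\mathcal I_1,\dots,\mathcal I_k\}$ be a set of distinct nonzero principal ideals of $R$, and let $G_R(D)$ be the associated gcd-graph. Write $R=R_1\times R_2$, where $R_1$ (respectively $R_2$) is the product of the local factors of $R$ whose residue field is $\mathbb F_2$ (respectively is not $\mathbb F_2$), let $r$ be the number of local factors of $R$ with residue field $\mathbb F_2$, let $J(R_1)$ be the Jacobson radical of $R_1$, so that $R_1/J(R_1)\cong \mathbb F_2^r$, and let $\Phi\colon R\to R_1/J(R_1)=\mathbb F_2^r$ be the quotient ring homomorphism. Let $D'=\{\Phi(\mathcal I_1),\dots,\Phi(\mathcal I_k)\}$, with any zero ideal removed. Then $G_R(D)$ is connected if and only if the following two conditions hold: 1. $\mathcal I_1+\mathcal I_2+\cdots+\mathcal I_k=R$; 2. the graph $G_{\mathbb F_2^r}(D')$ is connected. Furthermore, suppose that these two conditions hold, and let $t$ be the smallest integer such that there exist $1\le i_1<i_2<\cdots<i_t\le k$ with $\mathcal I_{i_1}+\mathcal I_{i_2}+\cdots+\mathcal I_{i_t}=R$. Then $$t\le \operatorname{diam}(G_R(D))\le 2t+\operatorname{diam}(G_{\mathbb F_2^r}(D')).$$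
   Context: All rings are finite, commutative, associative and unital. For a finite ring $R$ and a set $D$ of nonzero principal ideals of $R$, the gcd-graph $G_R(D)$ is the graph with vertex set $R$ in which $x,y\in R$ are adjacent if and only if $x-y\in S$, where $S=\{s\in R: Rs\in D\}$ is its generating set. Every finite commutative ring is isomorphic to a finite product of local rings, called its local factors. The map $\Phi$ is the projection $R_1\times R_2\to R_1$ followed by the quotient map $R_1\to R_1/J(R_1)$; since it is surjective, each $\Phi(\mathcal I_i)$ is a principal ideal of $\mathbb F_2^r$. If $r=0$, then $\mathbb F_2^r$ is the zero ring. The diameter of a connected graph is the maximum distance between two vertices. -}

module Defs where

open import Algebra.Bundles using (CommutativeRing)
import Algebra.Construct.DirectProduct as DirectProduct
import Algebra.Construct.Pointwise as Pointwise
open import Algebra.Morphism.Structures using (IsRingHomomorphism; IsRingIsomorphism)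
import Algebra.Morphism.Construct.Composition as Composition
import Algebra.Properties.Ring as RingProperties
import Algebra.Properties.Semiring.Sum as Sum
open import Data.Bool.Properties using (xor-∧-commutativeRing)
open import Data.Fin.Base using (Fin) renaming (_<_ to _<ᶠ_)
open import Data.Nat.Base using (ℕ; zero; suc; _≤_)
open import Data.Product.Base using (Σ; Σ-syntax; ∃; ∃-syntax; _×_; _,_; proj₁; proj₂)
open import Data.Vec.Functional using (Vector)
open import Function.Base using (_∘_)
open import Function.Bundles using (Inverse)
import Function.Construct.Composition as FunctionComposition
open import Function.Definitions using (Surjective)
open import Level using (Level; _⊔_; 0ℓ) renaming (suc to lsuc)
open import Relation.Binary.Bundles using (Setoid)
open import Relation.Binary.Core using (Rel)
open import Relation.Binary.Definitions using (Symmetric; _Respects_; _Respects₂_)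
import Relation.Binary.PropositionalEquality as ≡
import Relation.Binary.Reasoning.Setoid as SetoidReasoning
open import Relation.Nullary using (¬_)
open import Relation.Unary using (Pred; _⊆_) renaming (_≐_ to _≐ᵖ_)

private
  variable
    c ℓ c′ ℓ′ c″ ℓ″ p q e i : Level

open CommutativeRing using (Carrier; rawRing; setoid)

-- Vertices are taken up to a setoid equality, so a walk of length zero joins
-- any two equal representatives.

record Graph (c ℓ e : Level) : Set (lsuc (c ⊔ ℓ ⊔ e)) where
  field
    vertices : Setoid c ℓ
  open Setoid vertices public using (_≈_) renaming (Carrier to Vertex)
  field
    _~_      : Rel Vertex e
    ~-resp-≈ : _~_ Respects₂ _≈_
    ~-sym    : Symmetric _~_
    ~-irrefl : ∀ x → ¬ (x ~ x)

module _ (G : Graph c ℓ e) where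
  open Graph G

  data Walk : ℕ → Vertex → Vertex → Set (c ⊔ ℓ ⊔ e) where
    stop : ∀ {x y} → x ≈ y → Walk zero x y
    step : ∀ {n x y z} → x ~ y → Walk n y z → Walk (suc n) x z

  IsConnected : Set (c ⊔ ℓ ⊔ e)
  IsConnected = ∀ x y → ∃[ n ] Walk n x y

  IsDistance : Vertex → Vertex → ℕ → Set (c ⊔ ℓ ⊔ e)
  IsDistance x y d = Walk d x y × (∀ n → Walk n x y → d ≤ n)

  IsDiameter : ℕ → Set (c ⊔ ℓ ⊔ e)
  IsDiameter d = (∃[ x ] ∃[ y ] IsDistance x y d)
               × (∀ x y m → IsDistance x y m → m ≤ d)

record Ideal (R : CommutativeRing c ℓ) (p : Level) : Set (c ⊔ ℓ ⊔ lsuc p) where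
  private module R = CommutativeRing R
  field
    member   : Pred R.Carrier p
    resp     : member Respects R._≈_
    0-closed : member R.0#
    +-closed : ∀ {x y} → member x → member y → member (x R.+ y)
    *-closed : ∀ r {x} → member x → member (r R.* x)

  neg-closed : ∀ {x} → member x → member (R.- x)
  neg-closed {x} x∈I = resp (RingProperties.-1*x≈-x R.ring x) (*-closed (R.- R.1#) x∈I)

open Ideal using (member)

module _ {R : CommutativeRing c ℓ} where
  private
    module R = CommutativeRing R
    module RP = RingProperties R.ring

  -- Equality of ideals as sets, across membership levels.
  infix 4 _≐_

  _≐_ : Ideal R p → Ideal R q → Set (c ⊔ p ⊔ q)
  I ≐ J = member I ≐ᵖ member J

  IsWhole : Ideal R p → Set (c ⊔ p)
  IsWhole I = ∀ x → member I x

  IsZero : Ideal R p → Set (c ⊔ ℓ ⊔ p)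
  IsZero I = ∀ {x} → member I x → x R.≈ R.0#

  principal : Carrier R → Ideal R (c ⊔ ℓ)
  principal a = record
    { member   = λ x → ∃[ r ] x R.≈ r R.* a
    ; resp     = λ x≈y (r , x≈ra) → r , R.trans (R.sym x≈y) x≈ra
    ; 0-closed = R.0# , R.sym (R.zeroˡ a)
    ; +-closed = λ (r , x≈ra) (s , y≈sa) →
        r R.+ s , R.trans (R.+-cong x≈ra y≈sa) (R.sym (R.distribʳ a r s))
    ; *-closed = λ s (r , x≈ra) →
        s R.* r , R.trans (R.*-congˡ x≈ra) (R.sym (R.*-assoc s r a))
    }

  IsPrincipal : Ideal R p → Set (c ⊔ ℓ ⊔ p)
  IsPrincipal I = ∃[ a ] I ≐ principal a

  open Sum R.semiring using (sum; sum-cong-≋; sum-replicate-zero; ∑-distrib-+; *-distribˡ-sum)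

  -- I₁ + ⋯ + Iₙ; for n = 0 this is the zero ideal.

  sumIdeal : ∀ {n} → (Fin n → Ideal R p) → Ideal R (c ⊔ ℓ ⊔ p)
  sumIdeal {n = n} I = record
    { member   = λ x → Σ[ f ∈ Vector R.Carrier n ] (∀ j → member (I j) (f j)) × x R.≈ sum f
    ; resp     = λ x≈y (f , f∈I , x≈∑) → f , f∈I , R.trans (R.sym x≈y) x≈∑
    ; 0-closed = (λ _ → R.0#) , (λ j → Ideal.0-closed (I j)) , R.sym (sum-replicate-zero n)
    ; +-closed = λ (f , f∈I , x≈∑) (g , g∈I , y≈∑) →
        (λ j → f j R.+ g j) , (λ j → Ideal.+-closed (I j) (f∈I j) (g∈I j)) ,
        R.trans (R.+-cong x≈∑ y≈∑) (R.sym (∑-distrib-+ f g))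
    ; *-closed = λ r (f , f∈I , x≈∑) →
        (λ j → r R.* f j) , (λ j → Ideal.*-closed (I j) r (f∈I j)) ,
        R.trans (R.*-congˡ x≈∑) (*-distribˡ-sum r f)
    }

  principal-cong : ∀ {a b} → a R.≈ b → principal a ≐ principal b
  principal-cong a≈b =
      (λ (r , x≈ra) → r , R.trans x≈ra (R.*-congˡ a≈b))
    , (λ (r , x≈rb) → r , R.trans x≈rb (R.*-congˡ (R.sym a≈b)))

  -[x-y]≈y-x : ∀ x y → R.- (x R.- y) R.≈ y R.- x
  -[x-y]≈y-x x y = begin
    R.- (x R.+ R.- y)         ≈⟨ RP.-‿+-comm x (R.- y) ⟨
    R.- x R.+ R.- (R.- y)     ≈⟨ R.+-congˡ (RP.-‿involutive y) ⟩
    R.- x R.+ y               ≈⟨ R.+-comm (R.- x) y ⟩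
    y R.- x                   ∎
    where open SetoidReasoning R.setoid

  [x-y]+[y-z]≈x-z : ∀ x y z → (x R.- y) R.+ (y R.- z) R.≈ x R.- z
  [x-y]+[y-z]≈x-z x y z = begin
    (x R.- y) R.+ (y R.- z)         ≈⟨ R.+-assoc x (R.- y) (y R.- z) ⟩
    x R.+ (R.- y R.+ (y R.- z))     ≈⟨ R.+-congˡ (R.+-assoc (R.- y) y (R.- z)) ⟨
    x R.+ ((R.- y R.+ y) R.- z)     ≈⟨ R.+-congˡ (R.+-congʳ (R.-‿inverseˡ y)) ⟩
    x R.+ (R.0# R.- z)              ≈⟨ R.+-congˡ (R.+-identityˡ (R.- z)) ⟩
    x R.- z                         ∎
    where open SetoidReasoning R.setoid

  [x+u]-[y+v]≈[x-y]+[u-v] : ∀ x y u v → (x R.+ u) R.- (y R.+ v) R.≈ (x R.- y) R.+ (u R.- v)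
  [x+u]-[y+v]≈[x-y]+[u-v] x y u v = begin
    (x R.+ u) R.- (y R.+ v)             ≈⟨ R.+-congˡ (RP.-‿+-comm y v) ⟨
    (x R.+ u) R.+ (R.- y R.+ R.- v)     ≈⟨ R.+-assoc x u _ ⟩
    x R.+ (u R.+ (R.- y R.+ R.- v))     ≈⟨ R.+-congˡ (R.+-assoc u (R.- y) (R.- v)) ⟨
    x R.+ ((u R.+ R.- y) R.+ R.- v)     ≈⟨ R.+-congˡ (R.+-congʳ (R.+-comm u (R.- y))) ⟩
    x R.+ ((R.- y R.+ u) R.+ R.- v)     ≈⟨ R.+-congˡ (R.+-assoc (R.- y) u (R.- v)) ⟩
    x R.+ (R.- y R.+ (u R.+ R.- v))     ≈⟨ R.+-assoc x (R.- y) _ ⟨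
    (x R.- y) R.+ (u R.- v)             ∎
    where open SetoidReasoning R.setoid

  xu-yv≈u[x-y]+y[u-v] : ∀ x y u v →
    (x R.* u) R.- (y R.* v) R.≈ u R.* (x R.- y) R.+ y R.* (u R.- v)
  xu-yv≈u[x-y]+y[u-v] x y u v = R.sym (begin
    u R.* (x R.- y) R.+ y R.* (u R.- v)
      ≈⟨ R.+-cong (RP.x[y-z]≈xy-xz u x y) (RP.x[y-z]≈xy-xz y u v) ⟩
    (u R.* x R.- u R.* y) R.+ (y R.* u R.- y R.* v)
      ≈⟨ R.+-cong (R.+-cong (R.*-comm u x) (R.-‿cong (R.*-comm u y))) R.refl ⟩
    (x R.* u R.- y R.* u) R.+ (y R.* u R.- y R.* v)
      ≈⟨ [x-y]+[y-z]≈x-z _ _ _ ⟩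
    x R.* u R.- y R.* v ∎)
    where open SetoidReasoning R.setoid

  principal-neg-⊆ : ∀ {a b} → R.- a R.≈ b → member (principal a) ⊆ member (principal b)
  principal-neg-⊆ {a} {b} -a≈b {x} (r , x≈ra) = R.- r , (begin
    x                     ≈⟨ x≈ra ⟩
    r R.* a               ≈⟨ R.*-congˡ (RP.-‿involutive a) ⟨
    r R.* (R.- (R.- a))   ≈⟨ R.*-congˡ (R.-‿cong -a≈b) ⟩
    r R.* (R.- b)         ≈⟨ RP.-‿distribʳ-* r b ⟨
    R.- (r R.* b)         ≈⟨ RP.-‿distribˡ-* r b ⟩
    R.- r R.* b           ∎)
    where open SetoidReasoning R.setoid

-- The set D is given as an indexed family, so R s ∈ D reads: R s equals
-- some D j.

module _ (R : CommutativeRing c ℓ) {K : Set i} (D : K → Ideal R p)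
         (D-nonzero : ∀ j → ¬ IsZero (D j)) where
  private module R = CommutativeRing R

  generatingSet : Pred R.Carrier (c ⊔ ℓ ⊔ p ⊔ i)
  generatingSet s = ∃[ j ] principal s ≐ D j

  private
    generatingSet-resp : generatingSet Respects R._≈_
    generatingSet-resp s≈t (j , s⊆ , ⊆s) with principal-cong {R = R} s≈t
    ... | s⊆t , t⊆s = j , (λ x → s⊆ (t⊆s x)) , (λ x → s⊆t (⊆s x))

  gcdGraph : Graph c ℓ (c ⊔ ℓ ⊔ p ⊔ i)
  gcdGraph = record
    { vertices = R.setoid
    ; _~_      = λ x y → generatingSet (x R.- y)
    ; ~-resp-≈ = (λ y≈z → generatingSet-resp (R.+-congˡ (R.-‿cong y≈z)))
               , (λ y≈z → generatingSet-resp (R.+-congʳ y≈z))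
    ; ~-sym    = λ {x} {y} (j , s⊆ , ⊆s) → j
               , (λ z → s⊆ (principal-neg-⊆ {R = R} (-[x-y]≈y-x {R = R} y x) z))
               , (λ z → principal-neg-⊆ {R = R} (-[x-y]≈y-x {R = R} x y) (⊆s z))
    ; ~-irrefl = λ x (j , _ , ⊆0) → D-nonzero j λ z →
        let (r , z≈) = ⊆0 z in
        R.trans z≈ (R.trans (R.*-congˡ (R.-‿inverseʳ x)) (R.zeroʳ r))
    }

infix 4 _≅_ _↠_

record _≅_ (R : CommutativeRing c ℓ) (S : CommutativeRing c′ ℓ′) : Set (c ⊔ ℓ ⊔ c′ ⊔ ℓ′) where
  field
    ⟦_⟧               : Carrier R → Carrier S
    isRingIsomorphism : IsRingIsomorphism (rawRing R) (rawRing S) ⟦_⟧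

record _↠_ (R : CommutativeRing c ℓ) (S : CommutativeRing c′ ℓ′) : Set (c ⊔ ℓ ⊔ c′ ⊔ ℓ′) where
  field
    ⟦_⟧                : Carrier R → Carrier S
    isRingHomomorphism : IsRingHomomorphism (rawRing R) (rawRing S) ⟦_⟧
    surjective         : Surjective (CommutativeRing._≈_ R) (CommutativeRing._≈_ S) ⟦_⟧

≅⇒↠ : {R : CommutativeRing c ℓ} {S : CommutativeRing c′ ℓ′} → R ≅ S → R ↠ S
≅⇒↠ f = record
  { ⟦_⟧                = _≅_.⟦_⟧ f
  ; isRingHomomorphism = isRingHomomorphism
  ; surjective         = surjective
  }
  where open IsRingIsomorphism (_≅_.isRingIsomorphism f)

infixr 9 _∘↠_

_∘↠_ : {R : CommutativeRing c ℓ} {S : CommutativeRing c′ ℓ′} {T : CommutativeRing c″ ℓ″} →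
       S ↠ T → R ↠ S → R ↠ T
_∘↠_ {R = R} {S = S} {T = T} g f = record
  { ⟦_⟧                = g.⟦_⟧ ∘ f.⟦_⟧
  ; isRingHomomorphism = Composition.isRingHomomorphism (CommutativeRing.trans T)
                           f.isRingHomomorphism g.isRingHomomorphism
  ; surjective         = FunctionComposition.surjective
                           (CommutativeRing._≈_ R) (CommutativeRing._≈_ S) (CommutativeRing._≈_ T)
                           f.surjective g.surjective
  }
  where
  module f = _↠_ f
  module g = _↠_ g

-- Surjectivity is what makes the set-theoretic image closed under
-- multiplication by elements of S.

image : {R : CommutativeRing c ℓ} {S : CommutativeRing c′ ℓ′} →
        R ↠ S → Ideal R p → Ideal S (c ⊔ ℓ′ ⊔ p)
image {R = R} {S = S} φ I = record
  { member   = λ y → ∃[ x ] member I x × φ.⟦ x ⟧ S.≈ y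
  ; resp     = λ y≈z (x , x∈I , φx≈y) → x , x∈I , S.trans φx≈y y≈z
  ; 0-closed = R.0# , I.0-closed , 0#-homo
  ; +-closed = λ (x , x∈I , φx≈) (y , y∈I , φy≈) →
      x R.+ y , I.+-closed x∈I y∈I , S.trans (+-homo x y) (S.+-cong φx≈ φy≈)
  ; *-closed = λ s (x , x∈I , φx≈) →
      let (r , φr≈s) = φ.surjective s in
      r R.* x , I.*-closed r x∈I , S.trans (*-homo r x) (S.*-cong (φr≈s R.refl) φx≈)
  }
  where
  module R = CommutativeRing R
  module S = CommutativeRing S
  module I = Ideal I
  module φ = _↠_ φ
  open IsRingHomomorphism φ.isRingHomomorphism

_/_ : (R : CommutativeRing c ℓ) → Ideal R p → CommutativeRing c p
R / I = record
  { Carrier = R.Carrier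
  ; _≈_     = λ x y → I.member (x R.- y)
  ; _+_     = R._+_
  ; _*_     = R._*_
  ; -_      = R.-_
  ; 0#      = R.0#
  ; 1#      = R.1#
  ; isCommutativeRing = record
    { isRing = record
      { +-isAbelianGroup = record
        { isGroup = record
          { isMonoid = record
            { isSemigroup = record
              { isMagma = record
                { isEquivalence = record
                  { refl  = ≈⇒∼ R.refl
                  ; sym   = sym
                  ; trans = λ {x} {y} {z} x∼y y∼z →
                      I.resp ([x-y]+[y-z]≈x-z {R = R} x y z) (I.+-closed x∼y y∼z)
                  }
                ; ∙-cong = λ {x} {y} {u} {v} x∼y u∼v →
                    I.resp (R.sym ([x+u]-[y+v]≈[x-y]+[u-v] {R = R} x y u v)) (I.+-closed x∼y u∼v)
                }
              ; assoc = λ x y z → ≈⇒∼ (R.+-assoc x y z)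
              }
            ; identity = (λ x → ≈⇒∼ (R.+-identityˡ x)) , (λ x → ≈⇒∼ (R.+-identityʳ x))
            }
          ; inverse = (λ x → ≈⇒∼ (R.-‿inverseˡ x)) , (λ x → ≈⇒∼ (R.-‿inverseʳ x))
          ; ⁻¹-cong = λ {x} {y} x∼y → I.resp (R.sym (RP.-‿+-comm x (R.- y))) (I.neg-closed x∼y)
          }
        ; comm = λ x y → ≈⇒∼ (R.+-comm x y)
        }
      ; *-cong = λ {x} {y} {u} {v} x∼y u∼v →
          I.resp (R.sym (xu-yv≈u[x-y]+y[u-v] {R = R} x y u v))
            (I.+-closed (I.*-closed u x∼y) (I.*-closed y u∼v))
      ; *-assoc = λ x y z → ≈⇒∼ (R.*-assoc x y z)
      ; *-identity = (λ x → ≈⇒∼ (R.*-identityˡ x)) , (λ x → ≈⇒∼ (R.*-identityʳ x))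
      ; distrib = (λ x y z → ≈⇒∼ (R.distribˡ x y z)) , (λ x y z → ≈⇒∼ (R.distribʳ x y z))
      }
    ; *-comm = λ x y → ≈⇒∼ (R.*-comm x y)
    }
  }
  where
  module R = CommutativeRing R
  module RP = RingProperties R.ring
  module I = Ideal I
  ≈⇒∼ : ∀ {x y} → x R.≈ y → I.member (x R.- y)
  ≈⇒∼ {x} {y} x≈y = I.resp (R.sym (R.trans (R.+-congʳ x≈y) (R.-‿inverseʳ y))) I.0-closed
  sym : ∀ {x y} → I.member (x R.- y) → I.member (y R.- x)
  sym {x} {y} x∼y = I.resp (-[x-y]≈y-x {R = R} x y) (I.neg-closed x∼y)

quotientMap : (R : CommutativeRing c ℓ) (I : Ideal R p) → R ↠ R / I
quotientMap R I = record
  { ⟦_⟧ = λ x → x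
  ; isRingHomomorphism = record
    { isSemiringHomomorphism = record
      { isNearSemiringHomomorphism = record
        { +-isMonoidHomomorphism = record
          { isMagmaHomomorphism = record
            { isRelHomomorphism = record { cong = ≈⇒∼ }
            ; homo = λ x y → Q.refl {x R.+ y}
            }
          ; ε-homo = Q.refl {R.0#}
          }
        ; *-homo = λ x y → Q.refl {x R.* y}
        }
      ; 1#-homo = Q.refl {R.1#}
      }
    ; -‿homo = λ x → Q.refl {R.- x}
    }
  ; surjective = λ y → y , ≈⇒∼
  }
  where
  module R = CommutativeRing R
  module Q = CommutativeRing (R / I)
  ≈⇒∼ : ∀ {x y} → x R.≈ y → x Q.≈ y
  ≈⇒∼ {x} {y} x≈y =
    Ideal.resp I (R.sym (R.trans (R.+-congʳ x≈y) (R.-‿inverseʳ y))) (Ideal.0-closed I)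

_×ᴿ_ : CommutativeRing c ℓ → CommutativeRing c′ ℓ′ → CommutativeRing (c ⊔ c′) (ℓ ⊔ ℓ′)
_×ᴿ_ = DirectProduct.commutativeRing

projection₁ : (R : CommutativeRing c ℓ) (S : CommutativeRing c′ ℓ′) → (R ×ᴿ S) ↠ R
projection₁ R S = record
  { ⟦_⟧ = proj₁
  ; isRingHomomorphism = record
    { isSemiringHomomorphism = record
      { isNearSemiringHomomorphism = record
        { +-isMonoidHomomorphism = record
          { isMagmaHomomorphism = record
            { isRelHomomorphism = record { cong = proj₁ }
            ; homo = λ _ _ → R.refl
            }
          ; ε-homo = R.refl
          }
        ; *-homo = λ _ _ → R.refl
        }
      ; 1#-homo = R.refl
      }
    ; -‿homo = λ _ → R.refl
    }
  ; surjective = λ x → (x , S.0#) , proj₁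
  }
  where
  module R = CommutativeRing R
  module S = CommutativeRing S

Πᴿ : ∀ {n} → (Fin n → CommutativeRing c ℓ) → CommutativeRing c ℓ
Πᴿ {n = n} L = record
  { Carrier = ∀ j → L.Carrier j
  ; _≈_     = λ x y → ∀ j → L._≈_ j (x j) (y j)
  ; _+_     = λ x y j → L._+_ j (x j) (y j)
  ; _*_     = λ x y j → L._*_ j (x j) (y j)
  ; -_      = λ x j → L.-_ j (x j)
  ; 0#      = λ j → L.0# j
  ; 1#      = λ j → L.1# j
  ; isCommutativeRing = record
    { isRing = record
      { +-isAbelianGroup = record
        { isGroup = record
          { isMonoid = record
            { isSemigroup = record
              { isMagma = record
                { isEquivalence = record
                  { refl  = λ j → L.refl j
                  ; sym   = λ x≈y j → L.sym j (x≈y j)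
                  ; trans = λ x≈y y≈z j → L.trans j (x≈y j) (y≈z j)
                  }
                ; ∙-cong = λ x≈y u≈v j → L.+-cong j (x≈y j) (u≈v j)
                }
              ; assoc = λ x y z j → L.+-assoc j (x j) (y j) (z j)
              }
            ; identity = (λ x j → L.+-identityˡ j (x j)) , (λ x j → L.+-identityʳ j (x j))
            }
          ; inverse = (λ x j → L.-‿inverseˡ j (x j)) , (λ x j → L.-‿inverseʳ j (x j))
          ; ⁻¹-cong = λ x≈y j → L.-‿cong j (x≈y j)
          }
        ; comm = λ x y j → L.+-comm j (x j) (y j)
        }
      ; *-cong = λ x≈y u≈v j → L.*-cong j (x≈y j) (u≈v j)
      ; *-assoc = λ x y z j → L.*-assoc j (x j) (y j) (z j)
      ; *-identity = (λ x j → L.*-identityˡ j (x j)) , (λ x j → L.*-identityʳ j (x j))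
      ; distrib = (λ x y z j → L.distribˡ j (x j) (y j) (z j))
                , (λ x y z j → L.distribʳ j (x j) (y j) (z j))
      }
    ; *-comm = λ x y j → L.*-comm j (x j) (y j)
    }
  }
  where module L (j : Fin n) = CommutativeRing (L j)

𝔽₂ : CommutativeRing 0ℓ 0ℓ
𝔽₂ = xor-∧-commutativeRing

𝔽₂^_ : ℕ → CommutativeRing 0ℓ 0ℓ
𝔽₂^ r = Pointwise.commutativeRing (Fin r) 𝔽₂

IsFinite : CommutativeRing c ℓ → Set (c ⊔ ℓ)
IsFinite R = ∃[ n ] Inverse (setoid R) (≡.setoid (Fin n))

module _ {R : CommutativeRing c ℓ} where

  IsMaximal : Ideal R (c ⊔ ℓ) → Set (lsuc (c ⊔ ℓ))
  IsMaximal m = ¬ IsWhole m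
              × (∀ (I : Ideal R (c ⊔ ℓ)) → member m ⊆ member I → ¬ IsWhole I → I ≐ m)

record FiniteLocalRing (c ℓ : Level) : Set (lsuc (c ⊔ ℓ)) where
  field
    ring          : CommutativeRing c ℓ
    finite        : IsFinite ring
    maximalIdeal  : Ideal ring (c ⊔ ℓ)
    isMaximal     : IsMaximal maximalIdeal
    uniqueMaximal : ∀ m → IsMaximal m → m ≐ maximalIdeal

  residueField : CommutativeRing c (c ⊔ ℓ)
  residueField = ring / maximalIdeal

-- The intersection of all maximal ideals; the universe level goes up
-- because membership quantifies over ideals.

jacobsonRadical : (R : CommutativeRing c ℓ) → Ideal R (lsuc (c ⊔ ℓ))
jacobsonRadical {c = c} {ℓ = ℓ} R = record
  { member   = λ x → ∀ (m : Ideal R (c ⊔ ℓ)) → IsMaximal m → member m x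
  ; resp     = λ x≈y x∈J m max → Ideal.resp m x≈y (x∈J m max)
  ; 0-closed = λ m _ → Ideal.0-closed m
  ; +-closed = λ x∈J y∈J m max → Ideal.+-closed m (x∈J m max) (y∈J m max)
  ; *-closed = λ r x∈J m max → Ideal.*-closed m r (x∈J m max)
  }

-- A decomposition of R into local factors, with the factors whose residue
-- field is 𝔽₂ (there are r of them) listed apart from the others.

record LocalDecomposition (R : CommutativeRing c ℓ) : Set (lsuc (c ⊔ ℓ)) where
  open FiniteLocalRing using (ring; residueField)
  field
    r s       : ℕ
    factors₁  : Fin r → FiniteLocalRing c ℓ
    factors₂  : Fin s → FiniteLocalRing c ℓ
    residue₁  : ∀ j → residueField (factors₁ j) ≅ 𝔽₂
    residue₂  : ∀ j → ¬ (residueField (factors₂ j) ≅ 𝔽₂)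

  R₁ : CommutativeRing c ℓ
  R₁ = Πᴿ (λ j → ring (factors₁ j))

  R₂ : CommutativeRing c ℓ
  R₂ = Πᴿ (λ j → ring (factors₂ j))

  field
    iso : R ≅ (R₁ ×ᴿ R₂)

  R₁/J : CommutativeRing c (lsuc (c ⊔ ℓ))
  R₁/J = R₁ / jacobsonRadical R₁

  -- θ is the chosen identification of R₁ / J(R₁) with 𝔽₂^r.

  Φ : R₁/J ≅ (𝔽₂^ r) → R ↠ (𝔽₂^ r)
  Φ θ = ≅⇒↠ θ ∘↠ quotientMap R₁ (jacobsonRadical R₁) ∘↠ projection₁ R₁ R₂ ∘↠ ≅⇒↠ iso

module _ {R : CommutativeRing c ℓ} {S : CommutativeRing c′ ℓ′} (φ : R ↠ S)
         {k : ℕ} (I : Fin k → Ideal R p) where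

  NonzeroImage : Set (c ⊔ c′ ⊔ ℓ′ ⊔ p)
  NonzeroImage = Σ[ j ∈ Fin k ] ¬ IsZero (image φ (I j))

  nonzeroImages : NonzeroImage → Ideal S (c ⊔ ℓ′ ⊔ p)
  nonzeroImages (j , _) = image φ (I j)

  nonzeroImages-nonzero : ∀ j → ¬ IsZero (nonzeroImages j)
  nonzeroImages-nonzero = proj₂

module _ {R : CommutativeRing c ℓ} {k : ℕ} (I : Fin k → Ideal R p) where

  HasGeneratingSubfamily : ℕ → Set (c ⊔ ℓ ⊔ p)
  HasGeneratingSubfamily t =
    Σ[ ι ∈ (Fin t → Fin k) ] (∀ {a b} → a <ᶠ b → ι a <ᶠ ι b) × IsWhole (sumIdeal (I ∘ ι))

  IsLeastGeneratingSize : ℕ → Set (c ⊔ ℓ ⊔ p)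
  IsLeastGeneratingSize t =
    HasGeneratingSubfamily t × (∀ t′ → HasGeneratingSubfamily t′ → t ≤ t′)

{-# OPTIONS --safe #-}

-- Write I j = R (a j). Every u * a j with u a unit generates I j, and the residue map Φ
-- turns walks of G into walks of G′, up to repeated vertices. Conversely 𝔽₂^r is Boolean,
-- so the only generator of Φ (I j) is Φ (a j) and walks of G′ lift to G. If Φ w = 0 then w
-- is a sum of two units: over a local factor with residue field 𝔽₂ the component of w lies
-- in the maximal ideal, so w = 1 + (w - 1) works, and any other residue field contains
-- some e ≠ 0 , 1, so a unit w splits as w e + w (1 - e). Hence if I (ι 1) + ⋯ + I (ι t) = R
-- and Φ x = Φ y, then x - y = Σ wᵢ a (ι i) with wᵢ ∈ ker Φ, a sum of 2t elements of the
-- generating set. For the lower bound, the ideals met along a walk from 1 to 0 generate R.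
-- Constructively, the maximal ideal of a finite local ring is its set of nonunits, and
-- being a unit is decidable by search.
module Submission where

open import Defs
open import Algebra.Bundles using (CommutativeRing)
open import Algebra.Morphism.Structures using (IsRingHomomorphism; IsRingIsomorphism)
import Algebra.Properties.Group as GroupProperties
import Algebra.Properties.Ring as RingProperties
import Algebra.Properties.Semiring.Sum as Sum
import Algebra.Solver.Ring.NaturalCoefficients.Default as NaturalSolver
open import Data.Bool.Base using (Bool; true; false; _∧_; _xor_; if_then_else_)
open import Data.Bool.Properties using (∧-idem; _≟_)
open import Data.Fin.Base using (Fin; zero; suc) renaming (_<_ to _<ᶠ_)
open import Data.Fin.Properties using (all?; any?; inj⇒≟)
open import Data.Fin.Subset using (Subset; ⁅_⁆; ⊥; _∈_; _∪_; ∣_∣; inside; outside)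
open import Data.Fin.Subset.Properties using (∪-identityˡ; p⊆p∪q; q⊆p∪q; x∈⁅x⁆; ∣⊥∣≡0)
open import Data.Nat.Base as ℕ using (ℕ; zero; suc; _≤_; z≤n; s≤s)
import Data.Nat.Properties as ℕ
open import Data.Nat.Induction using (<-rec)
open import Data.Product.Base using (Σ-syntax; ∃; ∃-syntax; _×_; _,_; proj₁; proj₂)
open import Data.Sum.Base using (_⊎_; inj₁; inj₂; [_,_])
open import Data.Vec.Base using ([]; _∷_; here; there)
open import Function.Base using (_∘_; id)
open import Function.Bundles using (_⇔_; mk⇔; Equivalence; Inverse)
open import Function.Properties.Inverse using (Inverse⇒Injection)
open import Level using (Level; _⊔_; 0ℓ)
open import Relation.Binary.Bundles using (Setoid)
open import Relation.Binary.Definitions using (_Respects_) renaming (Decidable to Decidable₂)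
open import Relation.Binary.PropositionalEquality as ≡ using (_≡_; _≢_)
import Relation.Binary.Reasoning.Setoid as SetoidReasoning
open import Relation.Nullary using (¬_; Dec; yes; no; contradiction)
open import Relation.Nullary.Decidable using (map′; decidable-stable; _×-dec_)
open import Relation.Unary using (Pred; Decidable; _⊆_)

private
  variable
    c ℓ c′ ℓ′ p q : Level

open Ideal using (member)

-- Units and ideals of a commutative ring.

module _ (R : CommutativeRing c ℓ) where
  open CommutativeRing R hiding (zero)

  IsUnit : Pred Carrier (c ⊔ ℓ)
  IsUnit u = ∃[ v ] v * u ≈ 1#

  IsBoolean : Set (c ⊔ ℓ)
  IsBoolean = ∀ b → b * b ≈ b

  HasDecidableZero : Set (c ⊔ ℓ)
  HasDecidableZero = ∀ b → Dec (b ≈ 0#)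

  SumOfTwoUnits : Pred Carrier (c ⊔ ℓ)
  SumOfTwoUnits w = ∃[ u ] ∃[ v ] IsUnit u × IsUnit v × w ≈ u + v

module RingFacts (R : CommutativeRing c ℓ) where
  open CommutativeRing R hiding (zero)
  open RingProperties ring
  open NaturalSolver commutativeSemiring using (solve; _:+_; _:*_; _:=_)
  open SetoidReasoning setoid

  [x-y]+y≈x : ∀ x y → (x - y) + y ≈ x
  [x-y]+y≈x x y = trans (+-assoc x (- y) y) (trans (+-congˡ (-‿inverseˡ y)) (+-identityʳ x))

  [x+y]-y≈x : ∀ x y → (x + y) - y ≈ x
  [x+y]-y≈x x y = trans (+-assoc x y (- y)) (trans (+-congˡ (-‿inverseʳ y)) (+-identityʳ x))

  x-[x-y]≈y : ∀ x y → x - (x - y) ≈ y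
  x-[x-y]≈y x y = begin
    x - (x - y)    ≈⟨ +-congˡ (-[x-y]≈y-x {R = R} x y) ⟩
    x + (y - x)    ≈⟨ +-comm x (y - x) ⟩
    (y - x) + x    ≈⟨ [x-y]+y≈x y x ⟩
    y              ∎

  x-0≈x : ∀ x → x - 0# ≈ x
  x-0≈x x = trans (+-congˡ -0#≈0#) (+-identityʳ x)

  1-unit : IsUnit R 1#
  1-unit = 1# , *-identityˡ 1#

  *-unit : ∀ {u v} → IsUnit R u → IsUnit R v → IsUnit R (u * v)
  *-unit {u} {v} (u′ , u′u≈1) (v′ , v′v≈1) = u′ * v′ , (begin
    (u′ * v′) * (u * v)    ≈⟨ solve 4 (λ a b x y → (a :* b) :* (x :* y) := (a :* x) :* (b :* y))
                                refl u′ v′ u v ⟩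
    (u′ * u) * (v′ * v)    ≈⟨ *-cong u′u≈1 v′v≈1 ⟩
    1# * 1#                ≈⟨ *-identityˡ 1# ⟩
    1#                     ∎)

  unit-resp : IsUnit R Respects _≈_
  unit-resp x≈y (v , vx≈1) = v , trans (*-congˡ (sym x≈y)) vx≈1

  1∈⇒whole : (I : Ideal R p) → member I 1# → IsWhole I
  1∈⇒whole I 1∈I x = Ideal.resp I (*-identityʳ x) (Ideal.*-closed I x 1∈I)

  unit∈⇒whole : (I : Ideal R p) → ∀ {u} → IsUnit R u → member I u → IsWhole I
  unit∈⇒whole I (v , vu≈1) u∈I = 1∈⇒whole I (Ideal.resp I vu≈1 (Ideal.*-closed I v u∈I))

  sub-closed : (I : Ideal R p) → ∀ {x y} → member I x → member I y → member I (x - y)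
  sub-closed I x∈I y∈I = Ideal.+-closed I x∈I (Ideal.neg-closed I y∈I)

  principal-unit-* : ∀ {u} a → IsUnit R u → _≐_ {R = R} (principal {R = R} (u * a)) (principal {R = R} a)
  principal-unit-* {u} a (v , vu≈1) =
      (λ (r , x≈) → r * u , trans x≈ (sym (*-assoc r u a)))
    , λ {x} (r , x≈ra) → r * v , (begin
        x                      ≈⟨ x≈ra ⟩
        r * a                  ≈⟨ *-congʳ (*-identityʳ r) ⟨
        (r * 1#) * a           ≈⟨ *-congʳ (*-congˡ vu≈1) ⟨
        (r * (v * u)) * a      ≈⟨ solve 4 (λ r v u a → (r :* (v :* u)) :* a := (r :* v) :* (u :* a))
                                    refl r v u a ⟩
        (r * v) * (u * a)      ∎)

  summand⊆sumIdeal : ∀ {n} (I : Fin n → Ideal R p) i → member (I i) ⊆ member (sumIdeal {R = R} I)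
  summand⊆sumIdeal {n = suc n} I zero {x} x∈I =
      (λ { zero → x ; (suc _) → 0# })
    , (λ { zero → x∈I ; (suc j) → Ideal.0-closed (I (suc j)) })
    , sym (trans (+-congˡ (Sum.sum-replicate-zero semiring n)) (+-identityʳ x))
  summand⊆sumIdeal I (suc i) x∈I with summand⊆sumIdeal (I ∘ suc) i x∈I
  ... | f , f∈I , x≈∑ =
      (λ { zero → 0# ; (suc j) → f j })
    , (λ { zero → Ideal.0-closed (I zero) ; (suc j) → f∈I j })
    , trans x≈∑ (sym (+-identityˡ _))

  adjoin : Ideal R (c ⊔ ℓ) → Carrier → Ideal R (c ⊔ ℓ)
  adjoin I y = record
    { member   = λ z → ∃[ a ] member I a × ∃[ r ] z ≈ a + r * y
    ; resp     = λ z≈w (a , a∈I , r , z≈) → a , a∈I , r , trans (sym z≈w) z≈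
    ; 0-closed = 0# , I.0-closed , 0# , sym (trans (+-identityˡ _) (zeroˡ y))
    ; +-closed = λ (a , a∈I , r , z≈) (b , b∈I , s , w≈) →
        a + b , I.+-closed a∈I b∈I , r + s ,
        trans (+-cong z≈ w≈)
          (solve 5 (λ a b r s y → (a :+ r :* y) :+ (b :+ s :* y) := (a :+ b) :+ (r :+ s) :* y)
            refl a b r s y)
    ; *-closed = λ t (a , a∈I , r , z≈) →
        t * a , I.*-closed t a∈I , t * r ,
        trans (*-congˡ z≈)
          (solve 4 (λ t a r y → t :* (a :+ r :* y) := t :* a :+ (t :* r) :* y) refl t a r y)
    }
    where module I = Ideal I

  ⊆-adjoin : ∀ I y → member I ⊆ member (adjoin I y)
  ⊆-adjoin I y {x} x∈I = x , x∈I , 0# , sym (trans (+-congˡ (zeroˡ y)) (+-identityʳ x))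

  ∈-adjoin : ∀ I y → member (adjoin I y) y
  ∈-adjoin I y = 0# , Ideal.0-closed I , 1# , sym (trans (+-identityˡ _) (*-identityˡ y))

  adjoin-⊆ : ∀ I (K : Ideal R p) {y} → member I ⊆ member K → member K y → member (adjoin I y) ⊆ member K
  adjoin-⊆ I K I⊆K y∈K (a , a∈I , r , z≈) =
    Ideal.resp K (sym z≈) (Ideal.+-closed K (I⊆K a∈I) (Ideal.*-closed K r y∈K))

  -- Maximality turns a refutation into a membership proof: if `1#` is not of the form `a + r * x`
  -- with `a` in `m`, then `adjoin m x` is `m` itself.
  ∈-maximal : ∀ {m x} → IsMaximal {R = R} m → ¬ IsWhole (adjoin m x) → member m x
  ∈-maximal {m} {x} (_ , max) ¬whole =
    proj₁ (max (adjoin m x) (⊆-adjoin m x) ¬whole) (∈-adjoin m x)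

-- Finite rings: decision by search and existence of maximal ideals.

module FiniteRing (R : CommutativeRing c ℓ) (finite : IsFinite R) where
  open CommutativeRing R hiding (zero)

  open RingFacts R
  private
    module F = Inverse (proj₂ finite)

  _≈?_ : Decidable₂ _≈_
  _≈?_ = inj⇒≟ (Inverse⇒Injection (proj₂ finite))

  -- The enumeration reaches each element only up to `≈`, so `P` has to respect it.
  ∃? : {P : Pred Carrier p} → P Respects _≈_ → Decidable P → Dec (∃ P)
  ∃? {P = P} resp P? = map′ (λ (i , Pi) → F.from i , Pi)
    (λ (x , Px) → F.to x , resp (sym (F.strictlyInverseʳ x)) Px)
    (any? (P? ∘ F.from))

  unit? : Decidable (IsUnit R)
  unit? u = ∃? (λ v≈w vu≈1 → trans (*-congʳ (sym v≈w)) vu≈1) (λ v → (v * u) ≈? 1#)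

  principal? : ∀ a → Decidable (member (principal {R = R} a))
  principal? a x = ∃? (λ r≈s x≈ra → trans x≈ra (*-congʳ r≈s)) (λ r → x ≈? (r * a))

  adjoin? : ∀ I y → Decidable (member I) → Decidable (member (adjoin I y))
  adjoin? I y I? z =
    ∃? (λ a≈b (a∈I , r , z≈) → Ideal.resp I a≈b a∈I , r , trans z≈ (+-congʳ a≈b))
       (λ a → I? a ×-dec
         ∃? (λ r≈s z≈ → trans z≈ (+-congˡ (*-congʳ r≈s))) (λ r → z ≈? (a + r * y)))

  -- Greedily adjoin the listed elements as long as the ideal stays proper.
  saturate : ∀ {n} (f : Fin n → Carrier) (I : Ideal R (c ⊔ ℓ)) → Decidable (member I) →
    ¬ member I 1# →
    Σ[ M ∈ Ideal R (c ⊔ ℓ) ] member I ⊆ member M × ¬ member M 1# ×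
      (∀ (K : Ideal R (c ⊔ ℓ)) → member M ⊆ member K → ¬ member K 1# →
        ∀ i → member K (f i) → member M (f i))
  saturate {zero}  f I I? 1∉I = I , id , 1∉I , λ _ _ _ ()
  saturate {suc n} f I I? 1∉I with adjoin? I (f zero) I? 1#
  ... | yes 1∈I+f = let (M , I⊆M , 1∉M , max) = saturate (f ∘ suc) I I? 1∉I in
    M , I⊆M , 1∉M , λ where
      K M⊆K 1∉K zero    f∈K → contradiction (adjoin-⊆ I K (λ z → M⊆K (I⊆M z)) f∈K 1∈I+f) 1∉K
      K M⊆K 1∉K (suc i) f∈K → max K M⊆K 1∉K i f∈K
  ... | no 1∉I+f =
    let (M , I⊆M , 1∉M , max) = saturate (f ∘ suc) (adjoin I (f zero)) (adjoin? I (f zero) I?) 1∉I+f in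
    M , (λ z → I⊆M (⊆-adjoin I (f zero) z)) , 1∉M , λ where
      K M⊆K 1∉K zero    f∈K → I⊆M (∈-adjoin I (f zero))
      K M⊆K 1∉K (suc i) f∈K → max K M⊆K 1∉K i f∈K

  -- Saturating along the enumeration of the whole ring tests every element up to `≈`, so a proper
  -- ideal above `M` has nothing new to contain.
  ⊆-maximal : (I : Ideal R (c ⊔ ℓ)) → Decidable (member I) → ¬ member I 1# →
              Σ[ M ∈ Ideal R (c ⊔ ℓ) ] member I ⊆ member M × IsMaximal {R = R} M
  ⊆-maximal I I? 1∉I = let (M , I⊆M , 1∉M , max) = saturate F.from I I? 1∉I in
    M , I⊆M , (λ whole → 1∉M (whole 1#)) , λ K M⊆K ¬whole →
      (λ {x} x∈K → Ideal.resp M (F.strictlyInverseʳ x)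
        (max K M⊆K (¬whole ∘ 1∈⇒whole K) (F.to x)
          (Ideal.resp K (sym (F.strictlyInverseʳ x)) x∈K)))
      , M⊆K

-- Finite local rings and sums of two units.

module LocalRing (L : FiniteLocalRing c ℓ) where
  open FiniteLocalRing L renaming (ring to R; maximalIdeal to m) public
  open CommutativeRing R hiding (zero)
  open RingProperties ring using (-1*x≈-x; -‿involutive)
  open RingFacts R
  open FiniteRing R finite
  open SetoidReasoning setoid
  private
    module m = Ideal m
    module k = CommutativeRing residueField

  1∉m : ¬ member m 1#
  1∉m 1∈m = proj₁ isMaximal (1∈⇒whole m 1∈m)

  -- The principal ideal of a nonunit is proper, so it lies in some maximal ideal, and `m` is the
  -- only one.
  nonunit∈m : ∀ {x} → ¬ IsUnit R x → member m x
  nonunit∈m {x} ¬unit =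
    let (M , x⊆M , max) = ⊆-maximal (principal {R = R} x) (principal? x)
                            (λ (v , 1≈vx) → ¬unit (v , sym 1≈vx))
    in proj₁ (uniqueMaximal M max) (x⊆M (1# , sym (*-identityˡ x)))

  unit∉m : ∀ {x} → IsUnit R x → ¬ member m x
  unit∉m unit x∈m = proj₁ isMaximal (unit∈⇒whole m unit x∈m)

  ∉m⇒unit : ∀ {x} → ¬ member m x → IsUnit R x
  ∉m⇒unit x∉m = decidable-stable (unit? _) (x∉m ∘ nonunit∈m)

  m? : Decidable (member m)
  m? x with unit? x
  ... | yes unit = no (unit∉m unit)
  ... | no ¬unit = yes (nonunit∈m ¬unit)

  -- Total in `x`, so that it can be applied in all components of a product at once; for a nonunit
  -- the value `0#` is a mere placeholder.
  quasiInverse : ∀ x → ∃[ v ] (member m x ⊎ v * x ≈ 1#)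
  quasiInverse x with unit? x
  ... | yes (v , vx≈1) = v , inj₂ vx≈1
  ... | no ¬unit       = 0# , inj₁ (nonunit∈m ¬unit)

  ∈m⇒sumOfTwoUnits : ∀ {x} → member m x → SumOfTwoUnits R x
  ∈m⇒sumOfTwoUnits {x} x∈m =
    1# , x - 1# , 1-unit ,
    ∉m⇒unit (λ x-1∈m → 1∉m (m.resp (x-[x-y]≈y x 1#) (sub-closed m x∈m x-1∈m))) ,
    sym (trans (+-comm 1# (x - 1#)) ([x-y]+y≈x x 1#))

  fromBool : Bool → Carrier
  fromBool b = if b then 1# else 0#

  -- If no e has both e and 1 - e invertible, every residue class is 0 or 1.
  residueField≅𝔽₂ : (∀ e → ¬ (IsUnit R e × IsUnit R (1# - e))) → residueField ≅ 𝔽₂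
  residueField≅𝔽₂ ¬split = record
    { ⟦_⟧ = toBool
    ; isRingIsomorphism = record
      { isRingMonomorphism = record
        { isRingHomomorphism = record
          { isSemiringHomomorphism = record
            { isNearSemiringHomomorphism = record
              { +-isMonoidHomomorphism = record
                { isMagmaHomomorphism = record
                  { isRelHomomorphism = record
                    { cong = λ {x} {y} x∼y → toBool-unique (k.trans x∼y (toBool-∼ y)) }
                  ; homo = λ x y → toBool-unique
                      (k.trans (k.+-cong (toBool-∼ x) (toBool-∼ y))
                        (k.sym (xor-homo (toBool x) (toBool y))))
                  }
                ; ε-homo = toBool-unique (k.refl {0#})
                }
              ; *-homo = λ x y → toBool-unique
                  (k.trans (k.*-cong (toBool-∼ x) (toBool-∼ y))
                    (k.sym (∧-homo (toBool x) (toBool y))))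
              }
            ; 1#-homo = toBool-unique (k.refl {1#})
            }
          ; -‿homo = λ x → toBool-unique
              (k.trans (k.-‿cong (toBool-∼ x)) (k.sym (neg-homo (toBool x))))
          }
        ; injective = λ {x} {y} eq →
            k.trans (toBool-∼ x) (k.trans (k.reflexive (≡.cong fromBool eq)) (k.sym (toBool-∼ y)))
        }
      ; surjective = λ b → fromBool b , λ z∼b → toBool-unique z∼b
      }
    }
    where
    toBool : Carrier → Bool
    toBool x with m? x
    ... | yes _ = false
    ... | no  _ = true

    toBool-∼ : ∀ x → x k.≈ fromBool (toBool x)
    toBool-∼ x with m? x
    ... | yes x∈m = m.resp (sym (x-0≈x x)) x∈m
    ... | no  x∉m = k.sym {1#} {x}
      (nonunit∈m (λ unit → ¬split x (∉m⇒unit x∉m , unit)))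

    fromBool-injective : ∀ a b → fromBool a k.≈ fromBool b → a ≡ b
    fromBool-injective false false _   = ≡.refl
    fromBool-injective true  true  _   = ≡.refl
    fromBool-injective false true  0∼1 = contradiction (m.resp (x-0≈x 1#) (k.sym {0#} {1#} 0∼1)) 1∉m
    fromBool-injective true  false 1∼0 = contradiction (m.resp (x-0≈x 1#) 1∼0) 1∉m

    -- Reduces each homomorphism law for `toBool` to a congruence between representatives `0#` and
    -- `1#` modulo `m`.
    toBool-unique : ∀ {x b} → x k.≈ fromBool b → toBool x ≡ b
    toBool-unique {x} {b} x∼b =
      fromBool-injective (toBool x) b (k.trans (k.sym (toBool-∼ x)) x∼b)

    -- The hypothesis at `e = - 1#`: since `- 1#` is a unit, `1# - (- 1#)` is not one, and so lies
    -- in `m`.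
    -1∼1 : k.- 1# k.≈ 1#
    -1∼1 = k.sym {1#} { - 1# } (nonunit∈m λ unit →
      ¬split (- 1#) ((- 1# , trans (-1*x≈-x (- 1#)) (-‿involutive 1#)) , unit))

    neg-homo : ∀ a → fromBool a k.≈ k.- fromBool a
    neg-homo false = k.sym { - 0# } {0#}
      (k.trans { - 0# } (k.sym (k.+-identityˡ (- 0#))) (k.-‿inverseʳ 0#))
    neg-homo true  = k.sym { - 1# } {1#} -1∼1

    xor-homo : ∀ a b → fromBool (a xor b) k.≈ fromBool a k.+ fromBool b
    xor-homo false b     = k.sym (k.+-identityˡ (fromBool b))
    xor-homo true  false = k.sym (k.+-identityʳ 1#)
    xor-homo true  true  = k.sym (k.trans (k.+-congʳ (k.sym -1∼1)) (k.-‿inverseˡ 1#))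

    ∧-homo : ∀ a b → fromBool (a ∧ b) k.≈ fromBool a k.* fromBool b
    ∧-homo false b = k.sym (k.zeroˡ (fromBool b))
    ∧-homo true  b = k.sym (k.*-identityˡ (fromBool b))

  -- Search decides whether some `e` has both `e` and `1# - e` invertible, so the negative
  -- hypothesis yields an actual `e`.
  sumOfTwoUnits : ¬ (residueField ≅ 𝔽₂) → ∀ x → SumOfTwoUnits R x
  sumOfTwoUnits ≇𝔽₂ x with m? x
  ... | yes x∈m = ∈m⇒sumOfTwoUnits x∈m
  ... | no  x∉m with ∃? (λ e≈f (u , v) → unit-resp e≈f u , unit-resp (+-congˡ (-‿cong e≈f)) v)
                         (λ e → unit? e ×-dec unit? (1# - e))
  ... | no ¬split = contradiction (residueField≅𝔽₂ λ e split → ¬split (e , split)) ≇𝔽₂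
  ... | yes (e , e-unit , 1-e-unit) =
    x * e , x * (1# - e) , *-unit (∉m⇒unit x∉m) e-unit , *-unit (∉m⇒unit x∉m) 1-e-unit , (begin
      x                        ≈⟨ *-identityʳ x ⟨
      x * 1#                   ≈⟨ *-congˡ ([x-y]+y≈x 1# e) ⟨
      x * ((1# - e) + e)       ≈⟨ *-congˡ (+-comm (1# - e) e) ⟩
      x * (e + (1# - e))       ≈⟨ distribˡ x e (1# - e) ⟩
      x * e + x * (1# - e)     ∎)

-- Products of local rings and their Jacobson radical.

module LocalProduct {n} (L : Fin n → FiniteLocalRing c ℓ) where
  private
    module L (j : Fin n) = LocalRing (L j)
    module P = CommutativeRing (Πᴿ (λ j → L.R j))
    module R (j : Fin n) = CommutativeRing (L.R j)

  P : CommutativeRing c ℓ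
  P = Πᴿ (λ j → L.R j)

  open RingFacts P

  componentIdeal : Fin n → Ideal P (c ⊔ ℓ)
  componentIdeal j = record
    { member   = λ x → member (L.m j) (x j)
    ; resp     = λ x≈y → Ideal.resp (L.m j) (x≈y j)
    ; 0-closed = Ideal.0-closed (L.m j)
    ; +-closed = Ideal.+-closed (L.m j)
    ; *-closed = λ r → Ideal.*-closed (L.m j) (r j)
    }

  -- Let `x` lie in `K` with `x j` invertible, and let `v` invert it in component `j`. Then
  -- `1 - v x` vanishes there, so it belongs to `componentIdeal j` and hence to `K`, which forces
  -- `1` into `K`. The other components of `v` do not matter.
  componentIdeal-maximal : ∀ j → IsMaximal {R = P} (componentIdeal j)
  componentIdeal-maximal j = (λ whole → L.1∉m j (whole P.1#)) , λ K m⊆K ¬whole →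
    (λ {x} x∈K → [ id , (λ vx≈1 → contradiction (1∈⇒whole K (1∈ K m⊆K x∈K vx≈1)) ¬whole) ]
      (proj₂ (L.quasiInverse j (x j)))) , m⊆K
    where
    inverses : P.Carrier → P.Carrier
    inverses x i = proj₁ (L.quasiInverse i (x i))

    1∈ : ∀ (K : Ideal P (c ⊔ ℓ)) → member (componentIdeal j) ⊆ member K → ∀ {x} → member K x →
         R._≈_ j (R._*_ j (inverses x j) (x j)) (R.1# j) → member K P.1#
    1∈ K m⊆K {x} x∈K vx≈1 =
      Ideal.resp K ([x-y]+y≈x P.1# (inverses x P.* x))
        (Ideal.+-closed K (m⊆K 1-vx∈m) (Ideal.*-closed K (inverses x) x∈K))
      where
      1-vx∈m : member (L.m j) ((P.1# P.- inverses x P.* x) j)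
      1-vx∈m = Ideal.resp (L.m j)
        (R.sym j (R.trans j (R.+-congˡ j (R.-‿cong j vx≈1)) (R.-‿inverseʳ j (R.1# j))))
        (Ideal.0-closed (L.m j))

  componentwise-unit : ∀ {u} → (∀ j → IsUnit (L.R j) (u j)) → IsUnit P u
  componentwise-unit units = (λ j → proj₁ (units j)) , λ j → proj₂ (units j)

  componentwise-sumOfTwoUnits : ∀ {w} → (∀ j → SumOfTwoUnits (L.R j) (w j)) → SumOfTwoUnits P w
  componentwise-sumOfTwoUnits sums =
    (λ j → proj₁ (sums j)) , (λ j → proj₁ (proj₂ (sums j))) ,
    componentwise-unit (λ j → proj₁ (proj₂ (proj₂ (sums j)))) ,
    componentwise-unit (λ j → proj₁ (proj₂ (proj₂ (proj₂ (sums j))))) ,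
    λ j → proj₂ (proj₂ (proj₂ (proj₂ (sums j))))

  ∈jacobson⇒∈m : ∀ {x} → member (jacobsonRadical P) x → ∀ j → member (L.m j) (x j)
  ∈jacobson⇒∈m x∈J j = x∈J (componentIdeal j) (componentIdeal-maximal j)

  -- If `M` together with `x` generated everything, then `1 = a + r x` with `a` in `M`. No component
  -- of `a` could lie in its maximal ideal, so `a` would be a unit inside `M`.
  ∈m⇒∈jacobson : ∀ {x} → (∀ j → member (L.m j) (x j)) → member (jacobsonRadical P) x
  ∈m⇒∈jacobson {x} x∈m M max = ∈-maximal {m = M} max λ whole →
    let (a , a∈M , r , 1≈a+rx) = whole P.1# in
    proj₁ max (unit∈⇒whole M
      (componentwise-unit λ j → L.∉m⇒unit j λ aj∈m →
        L.1∉m j (Ideal.resp (L.m j) (R.sym j (1≈a+rx j))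
          (Ideal.+-closed (L.m j) aj∈m (Ideal.*-closed (L.m j) (r j) (x∈m j)))))
      a∈M)

  -- By the two preceding inclusions the radical is the product of the maximal ideals, so the
  -- residue isomorphisms can be taken componentwise.
  quotient≅𝔽₂^n : (∀ j → L.residueField j ≅ 𝔽₂) → (P / jacobsonRadical P) ≅ (𝔽₂^ n)
  quotient≅𝔽₂^n residue = record
    { ⟦_⟧ = λ x j → ρ.⟦_⟧ j (x j)
    ; isRingIsomorphism = record
      { isRingMonomorphism = record
        { isRingHomomorphism = record
          { isSemiringHomomorphism = record
            { isNearSemiringHomomorphism = record
              { +-isMonoidHomomorphism = record
                { isMagmaHomomorphism = record
                  { isRelHomomorphism = record
                    { cong = λ x∼y j → ρ.⟦⟧-cong j (∈jacobson⇒∈m x∼y j) }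
                  ; homo = λ x y j → ρ.+-homo j (x j) (y j)
                  }
                ; ε-homo = λ j → ρ.0#-homo j
                }
              ; *-homo = λ x y j → ρ.*-homo j (x j) (y j)
              }
            ; 1#-homo = λ j → ρ.1#-homo j
            }
          ; -‿homo = λ x j → ρ.-‿homo j (x j)
          }
        ; injective = λ eq → ∈m⇒∈jacobson (λ j → ρ.injective j (eq j))
        }
      ; surjective = λ y →
          (λ j → proj₁ (ρ.surjective j (y j))) ,
          λ z∼x j → proj₂ (ρ.surjective j (y j)) (∈jacobson⇒∈m z∼x j)
      }
    }
    where
    module ρ (j : Fin n) where
      open _≅_ (residue j) public using (⟦_⟧)
      open IsRingIsomorphism (_≅_.isRingIsomorphism (residue j)) public

-- Transfer of two-unit sums and the kernel of the reduction map.

module _ {R : CommutativeRing c ℓ} {S : CommutativeRing c′ ℓ′} where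
  private
    module R = CommutativeRing R
    module S = CommutativeRing S

  sumOfTwoUnits-× : ∀ {x y} → SumOfTwoUnits R x → SumOfTwoUnits S y → SumOfTwoUnits (R ×ᴿ S) (x , y)
  sumOfTwoUnits-× (u , v , (u⁻¹ , u-inv) , (v⁻¹ , v-inv) , x≈)
                  (u′ , v′ , (u′⁻¹ , u′-inv) , (v′⁻¹ , v′-inv) , y≈) =
    (u , u′) , (v , v′) ,
    ((u⁻¹ , u′⁻¹) , (u-inv , u′-inv)) , ((v⁻¹ , v′⁻¹) , (v-inv , v′-inv)) , (x≈ , y≈)

  module _ (f : R ≅ S) where
    open _≅_ f using (⟦_⟧)
    open IsRingIsomorphism (_≅_.isRingIsomorphism f)

    preimage : ∀ s → ∃[ r ] ⟦ r ⟧ S.≈ s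
    preimage s = let (r , eq) = surjective s in r , eq R.refl

    ≅-reflects-unit : ∀ {r s} → ⟦ r ⟧ S.≈ s → IsUnit S s → IsUnit R r
    ≅-reflects-unit {r} fr≈s (v , vs≈1) = let (r′ , fr′≈v) = preimage v in
      r′ , injective (S.trans (*-homo r′ r)
        (S.trans (S.*-cong fr′≈v fr≈s) (S.trans vs≈1 (S.sym 1#-homo))))

    ≅-reflects-sumOfTwoUnits : ∀ {w} → SumOfTwoUnits S ⟦ w ⟧ → SumOfTwoUnits R w
    ≅-reflects-sumOfTwoUnits (u , v , u-unit , v-unit , w≈u+v) =
      let (u′ , fu′≈u) = preimage u
          (v′ , fv′≈v) = preimage v
      in u′ , v′ , ≅-reflects-unit fu′≈u u-unit , ≅-reflects-unit fv′≈v v-unit ,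
         injective (S.trans w≈u+v (S.sym (S.trans (+-homo u′ v′) (S.+-cong fu′≈u fv′≈v))))

module _ {R : CommutativeRing c ℓ} (decomposition : LocalDecomposition R) where
  open LocalDecomposition decomposition
  private
    module P₁ = LocalProduct factors₁
    module P₂ = LocalProduct factors₂

  module _ {S : CommutativeRing c′ ℓ′} (θ : R₁/J ≅ S) where
    private
      module S = CommutativeRing S
      module θ = IsRingIsomorphism (_≅_.isRingIsomorphism θ)

    -- The composite `Φ` with `𝔽₂^ r` replaced by any ring isomorphic to `R₁/J`.
    reduction : R ↠ S
    reduction = ≅⇒↠ θ ∘↠ quotientMap R₁ (jacobsonRadical R₁) ∘↠ projection₁ R₁ R₂ ∘↠ ≅⇒↠ iso

    -- The `R₁` part of `w` lies in the radical, hence componentwise in the maximal ideals; the `R₂`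
    -- part is arbitrary. Every component then splits, and the splittings assemble.
    reduction-kernel : ∀ w → _↠_.⟦ reduction ⟧ w S.≈ S.0# → SumOfTwoUnits R w
    reduction-kernel w φw≈0 = ≅-reflects-sumOfTwoUnits iso (sumOfTwoUnits-× {R = R₁} {S = R₂}
      (P₁.componentwise-sumOfTwoUnits λ j →
        LocalRing.∈m⇒sumOfTwoUnits (factors₁ j) (P₁.∈jacobson⇒∈m w₁∈J j))
      (P₂.componentwise-sumOfTwoUnits λ j →
        LocalRing.sumOfTwoUnits (factors₂ j) (residue₂ j) (w₂ j)))
      where
      w₁ = proj₁ (_≅_.⟦ iso ⟧ w)
      w₂ = proj₂ (_≅_.⟦ iso ⟧ w)
      w₁∈J : member (jacobsonRadical R₁) w₁
      w₁∈J = Ideal.resp (jacobsonRadical R₁) (RingFacts.x-0≈x R₁ w₁)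
        (θ.injective (S.trans φw≈0 (S.sym θ.0#-homo)))

-- Walks and diameters.

module _ {G : Graph c ℓ p} where
  open Graph G
  open Setoid vertices using (sym; trans)

  walk-respˡ : ∀ {n x y z} → x ≈ y → Walk G n y z → Walk G n x z
  walk-respˡ x≈y (stop y≈z)     = stop (trans x≈y y≈z)
  walk-respˡ x≈y (step y~w w⇝z) = step (proj₂ ~-resp-≈ (sym x≈y) y~w) w⇝z

  walk-respʳ : ∀ {n x y z} → y ≈ z → Walk G n x y → Walk G n x z
  walk-respʳ y≈z (stop x≈y)     = stop (trans x≈y y≈z)
  walk-respʳ y≈z (step x~w w⇝y) = step x~w (walk-respʳ y≈z w⇝y)

  walk-++ : ∀ {m n x y z} → Walk G m x y → Walk G n y z → Walk G (m ℕ.+ n) x z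
  walk-++ (stop x≈y)     y⇝z = walk-respˡ x≈y y⇝z
  walk-++ (step x~w w⇝y) y⇝z = step x~w (walk-++ w⇝y y⇝z)

  -- Existence of shortest walks is not constructive here, but it may be
  -- used when proving a decidable proposition.
  walk≤diameter : ∀ {d} {Q : Set q} → IsConnected G → IsDiameter G d → Dec Q → ∀ x y →
                  (∀ {n} → n ≤ d → Walk G n x y → Q) → Q
  walk≤diameter {d = d} connected (_ , ≤d) Q? x y f = decidable-stable Q? λ ¬Q →
    let (n , x⇝y) = connected x y in
    <-rec (λ n → ¬ Walk G n x y)
      (λ n shorter x⇝y → ¬Q (f (≤d x y n (x⇝y , λ m x⇝ₘy → ℕ.≮⇒≥ λ m<n → shorter m<n x⇝ₘy)) x⇝y))
      n x⇝y

map-walk : {G : Graph c ℓ p} {H : Graph c′ ℓ′ q} → ∀ {n x y} → Walk G n x y →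
           (f : Graph.Vertex G → Graph.Vertex H) →
           (∀ {x y} → Graph._≈_ G x y → Graph._≈_ H (f x) (f y)) →
           (∀ {x y} → Graph._~_ G x y → Graph._~_ H (f x) (f y)) →
           Walk H n (f x) (f y)
map-walk (stop x≈y)     f f-≈ f-~ = stop (f-≈ x≈y)
map-walk (step x~y y⇝z) f f-≈ f-~ = step (f-~ x~y) (map-walk y⇝z f f-≈ f-~)

-- Finite index sets and their enumeration.

∣⁅j⁆∪p∣≤1+∣p∣ : ∀ {k} (j : Fin k) p → ∣ ⁅ j ⁆ ∪ p ∣ ≤ suc ∣ p ∣
∣⁅j⁆∪p∣≤1+∣p∣ zero    (s ∷ p) rewrite ∪-identityˡ p with s
... | inside  = ℕ.n≤1+n _
... | outside = ℕ.≤-refl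
∣⁅j⁆∪p∣≤1+∣p∣ (suc j) (inside  ∷ p) = s≤s (∣⁅j⁆∪p∣≤1+∣p∣ j p)
∣⁅j⁆∪p∣≤1+∣p∣ (suc j) (outside ∷ p) = ∣⁅j⁆∪p∣≤1+∣p∣ j p

-- Lists `p` in increasing order, as `HasGeneratingSubfamily` requires of its index map.
enumerate : ∀ {k} (p : Subset k) → Fin ∣ p ∣ → Fin k
enumerate (inside  ∷ p) zero    = zero
enumerate (inside  ∷ p) (suc i) = suc (enumerate p i)
enumerate (outside ∷ p) i       = suc (enumerate p i)

enumerate-mono : ∀ {k} (p : Subset k) {a b} → a <ᶠ b → enumerate p a <ᶠ enumerate p b
enumerate-mono (inside  ∷ p) {zero}  {suc b} _         = s≤s z≤n
enumerate-mono (inside  ∷ p) {suc a} {suc b} (s≤s a<b) = s≤s (enumerate-mono p a<b)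
enumerate-mono (outside ∷ p) a<b                       = s≤s (enumerate-mono p a<b)

enumerate-surjective : ∀ {k} (p : Subset k) {j} → j ∈ p → ∃[ i ] enumerate p i ≡ j
enumerate-surjective (inside ∷ p)  here        = zero , ≡.refl
enumerate-surjective (inside ∷ p)  (there j∈p) =
  let (i , eq) = enumerate-surjective p j∈p in suc i , ≡.cong suc eq
enumerate-surjective (outside ∷ p) (there j∈p) =
  let (i , eq) = enumerate-surjective p j∈p in i , ≡.cong suc eq

-- Walks in a gcd-graph and sums of ideals: the lower bound.

module GcdGraph (R : CommutativeRing c ℓ) {k} (I : Fin k → Ideal R (c ⊔ ℓ))
                (I-nonzero : ∀ j → ¬ IsZero (I j)) where
  open CommutativeRing R hiding (zero)
  open RingFacts R

  private
    G = gcdGraph R I I-nonzero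

  generates⇒∈ : ∀ {j s} → _≐_ {R = R} (principal {R = R} s) (I j) → member (I j) s
  generates⇒∈ {s = s} (s⊆ , _) = s⊆ (1# , sym (*-identityˡ s))

  edge : ∀ {j s x y} → x ≈ s + y → _≐_ {R = R} (principal {R = R} s) (I j) → Graph._~_ G x y
  edge {j} {s} {x} {y} x≈s+y (s⊆ , ⊆s) =
    let (⊆ , ⊇) = principal-cong {R = R} (trans (+-congʳ x≈s+y) ([x+y]-y≈x s y)) in
    j , (λ z → s⊆ (⊆ z)) , (λ z → ⊇ (⊆s z))

  -- A subset rather than a list: an ideal used by several steps counts once, so the size is at most
  -- the length of the walk.
  walk-indices : ∀ {n x y} → Walk G n x y → Subset k
  walk-indices (stop _)           = ⊥
  walk-indices (step (j , _) y⇝z) = ⁅ j ⁆ ∪ walk-indices y⇝z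

  ∣walk-indices∣≤ : ∀ {n x y} (w : Walk G n x y) → ∣ walk-indices w ∣ ≤ n
  ∣walk-indices∣≤ (stop _)           = ℕ.≤-reflexive (∣⊥∣≡0 k)
  ∣walk-indices∣≤ (step (j , _) y⇝z) =
    ℕ.≤-trans (∣⁅j⁆∪p∣≤1+∣p∣ j (walk-indices y⇝z)) (s≤s (∣walk-indices∣≤ y⇝z))

  -- The difference of the endpoints telescopes into the steps. `K` is the sum of all the ideals for
  -- connectedness, and of those met by the walk for the lower bound.
  walk⇒∈ : (K : Ideal R p) → ∀ {n x y} (w : Walk G n x y) →
           (∀ {j} → j ∈ walk-indices w → member (I j) ⊆ member K) → member K (x - y)
  walk⇒∈ K {y = y} (stop x≈y) I⊆K =
    Ideal.resp K (sym (trans (+-congʳ x≈y) (-‿inverseʳ y))) (Ideal.0-closed K)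
  walk⇒∈ K {x = x} {z} (step {y = y} (j , x-y) y⇝z) I⊆K =
    Ideal.resp K ([x-y]+[y-z]≈x-z {R = R} x y z) (Ideal.+-closed K
      (I⊆K (p⊆p∪q (walk-indices y⇝z) (x∈⁅x⁆ j)) (generates⇒∈ x-y))
      (walk⇒∈ K y⇝z λ i∈ → I⊆K (q⊆p∪q ⁅ j ⁆ (walk-indices y⇝z) i∈)))

  connected⇒whole : IsConnected G → IsWhole (sumIdeal I)
  connected⇒whole connected x = let (_ , w) = connected x 0# in
    Ideal.resp (sumIdeal I) (x-0≈x x)
      (walk⇒∈ (sumIdeal I) w λ {j} _ → summand⊆sumIdeal I j)

  walk⇒generatingSubfamily : ∀ {n} → Walk G n 1# 0# → ∃[ t ] t ≤ n × HasGeneratingSubfamily I t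
  walk⇒generatingSubfamily w = ∣ js ∣ , ∣walk-indices∣≤ w , enumerate js , enumerate-mono js ,
    1∈⇒whole K (Ideal.resp K (x-0≈x 1#) (walk⇒∈ K w λ j∈js →
      let (i , eq) = enumerate-surjective js j∈js in
      ≡.subst (λ j → member (I j) ⊆ member K) eq (summand⊆sumIdeal (I ∘ enumerate js) i)))
    where
    js = walk-indices w
    K = sumIdeal (I ∘ enumerate js)

  leastGeneratingSize≤diameter : ∀ {t d} → IsConnected G → IsLeastGeneratingSize I t →
                                 IsDiameter G d → t ≤ d
  leastGeneratingSize≤diameter {t} {d} connected (_ , least) diam =
    walk≤diameter connected diam (t ℕ.≤? d) 1# 0# λ n≤d w →
      let (t′ , t′≤n , generates) = walk⇒generatingSubfamily w in
      ℕ.≤-trans (least t′ generates) (ℕ.≤-trans t′≤n n≤d)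

-- Passage to a Boolean quotient: projecting and lifting walks, and the upper bound.

module Reduction (R : CommutativeRing c ℓ) {k} (I : Fin k → Ideal R (c ⊔ ℓ))
                 (I-principal : ∀ j → IsPrincipal (I j)) (I-nonzero : ∀ j → ¬ IsZero (I j))
                 (S : CommutativeRing 0ℓ 0ℓ) (idempotent : IsBoolean S) (_≟0 : HasDecidableZero S)
                 (φ : R ↠ S) where
  private
    module S = CommutativeRing S
    module φ where
      open _↠_ φ public
      open IsRingHomomorphism isRingHomomorphism public
    G  = gcdGraph R I I-nonzero
    G′ = gcdGraph S (nonzeroImages φ I) (nonzeroImages-nonzero φ I)

  open CommutativeRing R hiding (zero)
  open RingFacts R
  open GcdGraph R I I-nonzero
  open Sum semiring using (sum; *-distribˡ-sum; sum-cong-≋)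
  open NaturalSolver commutativeSemiring using (solve; _:+_; _:*_; _:=_)

  φ-sub : ∀ x y → φ.⟦ x - y ⟧ S.≈ φ.⟦ x ⟧ S.- φ.⟦ y ⟧
  φ-sub x y = S.trans (φ.+-homo x (- y)) (S.+-congˡ (φ.-‿homo y))

  φ-preimage : ∀ b → ∃[ x ] φ.⟦ x ⟧ S.≈ b
  φ-preimage b = let (x , eq) = φ.surjective b in x , eq refl

  gen : Fin k → Carrier
  gen j = proj₁ (I-principal j)

  gen∈I : ∀ j → member (I j) (gen j)
  gen∈I j = proj₂ (proj₂ (I-principal j)) (1# , sym (*-identityˡ (gen j)))

  unit*gen : ∀ {u} j → IsUnit R u → _≐_ {R = R} (principal {R = R} (u * gen j)) (I j)
  unit*gen j u-unit =
    let (I⊆ , ⊆I) = proj₂ (I-principal j)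
        (⊆ , ⊇)   = principal-unit-* (gen j) u-unit
    in (λ z → ⊆I (⊆ z)) , (λ z → ⊇ (I⊆ z))

  -- Both equal their product, since the ring is Boolean.
  associates-≈ : ∀ {a b s t} → a S.≈ s S.* b → b S.≈ t S.* a → a S.≈ b
  associates-≈ {a} {b} {s} {t} a≈sb b≈ta =
    S.trans (absorb a≈sb) (S.trans (S.*-comm a b) (S.sym (absorb b≈ta)))
    where
    absorb : ∀ {a b s} → a S.≈ s S.* b → a S.≈ a S.* b
    absorb {a} {b} {s} a≈sb = S.trans a≈sb (S.trans (S.*-congˡ (S.sym (idempotent b)))
      (S.trans (S.sym (S.*-assoc s b b)) (S.*-congʳ (S.sym a≈sb))))

  -- Makes walks liftable: an edge of `G′` given by the image of `I j` can only be a translation by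
  -- the image of `gen j`.
  image-generator : ∀ {j b} → _≐_ {R = S} (principal {R = S} b) (image φ (I j)) → φ.⟦ gen j ⟧ S.≈ b
  image-generator {j} {b} (b⊆ , ⊆b) =
    let (x , x∈I , φx≈b) = b⊆ (S.1# , S.sym (S.*-identityˡ b))
        (s , x≈s*gen)    = proj₁ (proj₂ (I-principal j)) x∈I
        (t , φgen≈t*b)   = ⊆b (gen j , gen∈I j , S.refl)
    in associates-≈ φgen≈t*b
         (S.trans (S.sym φx≈b) (S.trans (φ.⟦⟧-cong x≈s*gen) (φ.*-homo s (gen j))))

  -- Zero images give no edges of `G′`. A step whose difference maps to zero has endpoints with
  -- equal images and is dropped, so the length may shrink.
  project-walk : ∀ {n x y} → Walk G n x y → ∃[ m ] Walk G′ m φ.⟦ x ⟧ φ.⟦ y ⟧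
  project-walk (stop x≈y) = zero , stop (φ.⟦⟧-cong x≈y)
  project-walk {x = x} (step {y = y} (j , x-y⊆I , I⊆x-y) w)
    with project-walk w | φ.⟦ x - y ⟧ ≟0
  ... | m , w′ | yes φ[x-y]≈0 = m , walk-respˡ
    (x-y≈0⇒x≈y (S.trans (S.sym (φ-sub x y)) φ[x-y]≈0)) w′
    where
    x-y≈0⇒x≈y : φ.⟦ x ⟧ S.- φ.⟦ y ⟧ S.≈ S.0# → φ.⟦ x ⟧ S.≈ φ.⟦ y ⟧
    x-y≈0⇒x≈y = GroupProperties.x∙y⁻¹≈ε⇒x≈y S.+-group φ.⟦ x ⟧ φ.⟦ y ⟧
  ... | m , w′ | no φ[x-y]≉0 = suc m , step
    ( (j , λ zero-image → φ[x-y]≉0 (zero-image (x - y , generates⇒∈ (x-y⊆I , I⊆x-y) , S.refl)))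
    , (λ (b , z≈) →
        let (s , φs≈b) = φ-preimage b in
        s * (x - y) , x-y⊆I (s , refl) ,
        S.trans (φ.*-homo s (x - y))
          (S.trans (S.*-cong φs≈b (φ-sub x y)) (S.sym z≈)))
    , λ (v , v∈I , φv≈z) →
        let (s , v≈) = I⊆x-y v∈I in
        φ.⟦ s ⟧ , S.trans (S.sym φv≈z)
          (S.trans (φ.⟦⟧-cong v≈) (S.trans (φ.*-homo s (x - y)) (S.*-congˡ (φ-sub x y)))) )
    w′

  connected⇒connected′ : IsConnected G → IsConnected G′
  connected⇒connected′ connected a b =
    let (x , φx≈a) = φ-preimage a
        (y , φy≈b) = φ-preimage b
        (m , w)    = project-walk (proj₂ (connected x y))
    in m , walk-respˡ (S.sym φx≈a) (walk-respʳ φy≈b w)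

  -- Each edge lifts to subtraction of `gen j`. The start is prescribed, but the end is controlled
  -- only up to the fibre of `φ`.
  lift-walk : ∀ {n b d} → Walk G′ n b d → ∀ {x} → φ.⟦ x ⟧ S.≈ b →
              ∃[ y ] φ.⟦ y ⟧ S.≈ d × Walk G n x y
  lift-walk (stop b≈d) {x} φx≈b = x , S.trans φx≈b b≈d , stop refl
  lift-walk (step {x = b} {y = e} ((j , _) , generates) w) {x} φx≈b =
    let (y , φy≈d , w′) = lift-walk w {x - gen j}
          (S.trans (φ-sub x (gen j))
            (S.trans (S.+-cong φx≈b (S.-‿cong (image-generator {j} generates)))
              (RingFacts.x-[x-y]≈y S b e)))
    in y , φy≈d , step (edge (sym (trans (+-congʳ (*-identityˡ (gen j)))
                         (trans (+-comm (gen j) (x - gen j)) ([x-y]+y≈x x (gen j)))))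
                         (unit*gen j 1-unit)) w′

  module _ (kernel : ∀ w → φ.⟦ w ⟧ S.≈ S.0# → SumOfTwoUnits R w) where

    -- Each coefficient is a sum of two units, so each summand costs two edges. The length is
    -- written `t ℕ.* 2` because it unfolds by two successors when `t` grows by one.
    combination-walk : ∀ {t} (ι : Fin t → Fin k) (w : Fin t → Carrier) →
      (∀ i → φ.⟦ w i ⟧ S.≈ S.0#) →
      ∀ {x y} → x ≈ sum (λ i → w i * gen (ι i)) + y → Walk G (t ℕ.* 2) x y
    combination-walk {zero}  ι w w∈ker x≈ = stop (trans x≈ (+-identityˡ _))
    combination-walk {suc t} ι w w∈ker {x} {y} x≈ =
      let (u , v , u-unit , v-unit , w≈u+v) = kernel (w zero) (w∈ker zero) in
      step (edge {y = v * gen (ι zero) + (rest + y)}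
             (trans x≈ (trans (+-congʳ (+-congʳ (*-congʳ w≈u+v)))
               (solve 5 (λ u v a s y → ((u :+ v) :* a :+ s) :+ y := u :* a :+ (v :* a :+ (s :+ y)))
                 refl u v (gen (ι zero)) rest y)))
             (unit*gen (ι zero) u-unit))
        (step (edge refl (unit*gen (ι zero) v-unit))
          (combination-walk (ι ∘ suc) (w ∘ suc) (w∈ker ∘ suc) refl))
      where rest = sum (λ i → w (suc i) * gen (ι (suc i)))

    -- Multiplying an expression of `1#` as a combination of generators by `x - y`, which is in the
    -- kernel, puts all coefficients in the kernel.
    fibre-walk : ∀ {t} (ι : Fin t → Fin k) → IsWhole (sumIdeal (I ∘ ι)) →
                 ∀ {x y} → φ.⟦ x ⟧ S.≈ φ.⟦ y ⟧ → Walk G (t ℕ.* 2) x y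
    fibre-walk ι whole {x} {y} φx≈φy =
      let (f , f∈I , 1≈∑f) = whole 1#
          coefficient i = proj₁ (proj₁ (proj₂ (I-principal (ι i))) (f∈I i))
          f≈ i = proj₂ (proj₁ (proj₂ (I-principal (ι i))) (f∈I i))
          z = x - y
      in combination-walk ι (λ i → z * coefficient i)
        (λ i → S.trans (φ.*-homo z (coefficient i))
          (S.trans (S.*-congʳ φz≈0) (S.zeroˡ φ.⟦ coefficient i ⟧)))
        (begin
          x                          ≈⟨ [x-y]+y≈x x y ⟨
          z + y                      ≈⟨ +-congʳ (*-identityʳ z) ⟨
          z * 1# + y                 ≈⟨ +-congʳ (*-congˡ 1≈∑f) ⟩
          z * sum f + y              ≈⟨ +-congʳ (*-distribˡ-sum z f) ⟩
          sum (λ i → z * f i) + y    ≈⟨ +-congʳ (sum-cong-≋ λ i →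
                                          trans (*-congˡ (f≈ i)) (sym (*-assoc z _ _))) ⟩
          sum (λ i → z * coefficient i * gen (ι i)) + y  ∎)
      where
      open SetoidReasoning setoid
      φz≈0 : φ.⟦ x - y ⟧ S.≈ S.0#
      φz≈0 = S.trans (φ-sub x y) (S.trans (S.+-congʳ φx≈φy) (S.-‿inverseʳ φ.⟦ y ⟧))

    -- The lifted walk ends in the fibre of `y`; a walk inside that fibre corrects the endpoint.
    detour : ∀ {t} (ι : Fin t → Fin k) → IsWhole (sumIdeal (I ∘ ι)) →
             ∀ {n x y} → Walk G′ n φ.⟦ x ⟧ φ.⟦ y ⟧ → Walk G (n ℕ.+ t ℕ.* 2) x y
    detour ι whole w = let (_ , φz≈φy , w′) = lift-walk w S.refl in
      walk-++ w′ (fibre-walk ι whole φz≈φy)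

    connected : IsWhole (sumIdeal I) → IsConnected G′ → IsConnected G
    connected whole connected′ x y =
      -- The index map `id` selects the whole family, so here `t` is `k`.
      let (_ , w) = connected′ φ.⟦ x ⟧ φ.⟦ y ⟧ in _ , detour id whole w

    -- Take `x` and `y` at distance `d`. A walk of length at most `d′` between their images,
    -- followed by the correction in the fibre, is at least `d` long.
    diameter≤ : ∀ {t d d′} → IsConnected G′ → HasGeneratingSubfamily I t →
                IsDiameter G d → IsDiameter G′ d′ → d ≤ 2 ℕ.* t ℕ.+ d′
    diameter≤ {t} {d} {d′} connected′ (ι , _ , whole) ((x , y , _ , d≤) , _) diam′ =
      walk≤diameter connected′ diam′ (d ℕ.≤? 2 ℕ.* t ℕ.+ d′) φ.⟦ x ⟧ φ.⟦ y ⟧ λ {n} n≤d′ w →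
        let open ℕ.≤-Reasoning in begin
        d                  ≤⟨ d≤ _ (detour ι whole w) ⟩
        n ℕ.+ t ℕ.* 2      ≡⟨ ℕ.+-comm n (t ℕ.* 2) ⟩
        t ℕ.* 2 ℕ.+ n      ≡⟨ ≡.cong (ℕ._+ n) (ℕ.*-comm t 2) ⟩
        2 ℕ.* t ℕ.+ n      ≤⟨ ℕ.+-monoʳ-≤ (2 ℕ.* t) n≤d′ ⟩
        2 ℕ.* t ℕ.+ d′     ∎

-- The criterion and the bounds over a Boolean quotient, then over `𝔽₂^ r`.

𝔽₂^-isBoolean : ∀ r → IsBoolean (𝔽₂^ r)
𝔽₂^-isBoolean r b i = ∧-idem (b i)

𝔽₂^-hasDecidableZero : ∀ r → HasDecidableZero (𝔽₂^ r)
𝔽₂^-hasDecidableZero r b = all? (λ i → b i ≟ false)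

module _ (R : CommutativeRing c ℓ) (decomposition : LocalDecomposition R)
         {k} (I : Fin k → Ideal R (c ⊔ ℓ))
         (I-principal : ∀ j → IsPrincipal (I j)) (I-nonzero : ∀ j → ¬ IsZero (I j))
         (S : CommutativeRing 0ℓ 0ℓ)
         (θ : LocalDecomposition.R₁/J decomposition ≅ S)
         (idempotent : IsBoolean S) (_≟0 : HasDecidableZero S) where

  connected⇔×diameter-bounds :
    let φ  = reduction decomposition θ
        G  = gcdGraph R I I-nonzero
        G′ = gcdGraph S (nonzeroImages φ I) (nonzeroImages-nonzero φ I)
    in
    (IsConnected G ⇔ (IsWhole (sumIdeal I) × IsConnected G′)) ×
    (IsWhole (sumIdeal I) → IsConnected G′ →
      ∀ (t d d′ : ℕ) →
      IsLeastGeneratingSize I t → IsDiameter G d → IsDiameter G′ d′ →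
      t ≤ d × d ≤ 2 ℕ.* t ℕ.+ d′)
  connected⇔×diameter-bounds =
    mk⇔ (λ conn → connected⇒whole conn , connected⇒connected′ conn)
        (λ (whole , conn′) → connected kernel whole conn′) ,
    λ whole conn′ t d d′ least diam diam′ →
      leastGeneratingSize≤diameter (connected kernel whole conn′) least diam ,
      diameter≤ kernel conn′ (proj₁ least) diam diam′
    where
    open GcdGraph R I I-nonzero
    open Reduction R I I-principal I-nonzero S idempotent _≟0 (reduction decomposition θ)
    kernel = reduction-kernel decomposition θ

open import Data.Nat.Base using (_+_; _*_)

theorem3p6 :
    ∀ {c ℓ : Level} (R : CommutativeRing c ℓ) → IsFinite R →
    (decomposition : LocalDecomposition R) →
    (k : ℕ) (I : Fin k → Ideal R (c ⊔ ℓ)) →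
    (∀ j → IsPrincipal (I j)) →
    (I-nonzero : ∀ j → ¬ IsZero (I j)) →
    (∀ {j j′} → j ≢ j′ → ¬ (I j ≐ I j′)) →
    let open LocalDecomposition decomposition in
    (R₁/J ≅ (𝔽₂^ r)) ×
    ((θ : R₁/J ≅ (𝔽₂^ r)) →
      let G  = gcdGraph R I I-nonzero
          G′ = gcdGraph (𝔽₂^ r) (nonzeroImages (Φ θ) I) (nonzeroImages-nonzero (Φ θ) I)
      in
      (IsConnected G ⇔ (IsWhole (sumIdeal I) × IsConnected G′)) ×
      (IsWhole (sumIdeal I) → IsConnected G′ →
        ∀ (t d d′ : ℕ) →
        IsLeastGeneratingSize I t → IsDiameter G d → IsDiameter G′ d′ →
        t ≤ d × d ≤ 2 * t + d′))
theorem3p6 R _ decomposition k I I-principal I-nonzero _ =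
  LocalProduct.quotient≅𝔽₂^n factors₁ residue₁ , λ θ →
    let r = LocalDecomposition.r decomposition
        (conn⇔ , bounds) = connected⇔×diameter-bounds R decomposition I I-principal I-nonzero
                             (𝔽₂^ r) θ (𝔽₂^-isBoolean r) (𝔽₂^-hasDecidableZero r)
        open Equivalence conn⇔
    in
    -- G′ and its copy in conn⇔ and bounds differ in how r and Φ unfold, and comparing
    -- the proofs stored in the two graphs takes Agda very long. Walks are therefore carried
    -- over by map-walk, which only compares adjacency; mk⇔ would compare the graphs.
    record
      { to        = λ conn → let (whole , conn′) = to conn in
                      whole , λ x y → _ , map-walk (proj₂ (conn′ x y)) id id id
      ; from      = λ (whole , conn′) →
                      from (whole , λ x y → _ , map-walk (proj₂ (conn′ x y)) id id id)
      ; to-cong   = λ { ≡.refl → ≡.refl }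
      ; from-cong = λ { ≡.refl → ≡.refl }
      } ,
    λ { whole conn′ t d d′ least diam ((x , y , w , shortest) , ≤d′) →
      bounds whole (λ x y → _ , map-walk (proj₂ (conn′ x y)) id id id) t d d′ least diam
        ( (x , y , map-walk w id id id , λ n w → shortest n (map-walk w id id id))
        , λ x y m (w , shortest) → ≤d′ x y m
            (map-walk w id id id , λ n w → shortest n (map-walk w id id id)) ) }
  where open LocalDecomposition decomposition using (factors₁; residue₁)
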